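{- Let $k\ge3$ and $2\le m\le k-1$ be integers. Put $$d=\min\{k-m,\,m-1\},\qquad E(m,k)=\left\lfloor\frac{md}{2}\right\rfloor.$$ Then for every integer $w\ge3$, $$\psi(w,k,m)\ \ge\ m\,\psi(w-1,k,m)+E(m,k)\,f(w-2,k).$$
   Context: All set families are finite families of distinct sets. A family is $w$-uniform if all its members have exactly $w$ elements (the ground set is an arbitrary finite set, not fixed). A $k$-sunflower is a collection of $k$ distinct sets $A_1,\dots,A_k$ for which there is a set $C$ (the core, possibly empty) with $A_i\cap A_j=C$ for all $i\ne j$. The matching number $\nu(\mathcal F)$ is the largest number of pairwise disjoint members of $\mathcal F$. For $w\ge1$, $k\ge2$, $f(w,k)$ denotes the maximum size of a $w$-uniform family containing no $k$-sunflower (finite by the Erdős–Rado sunflower lemma). For $m\ge2$, $\psi(w,k,m)$ denotes the maximum size of a $w$-uniform family $\mathcal F$ containing no $k$-sunflower and satisfying $\nu(\mathcal F)\le m-1$. -}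

module Defs where

open import Data.Fin.Base using (Fin)
open import Data.Fin.Subset using (Subset; _∩_; ∣_∣; Empty)
open import Data.Fin.Subset.Properties using (nonempty?)
open import Data.List.Base using (List; []; _∷_; _++_; map; filter; length)
open import Data.List.Extrema.Nat using (max)
open import Data.List.Membership.Propositional using (_∈_)
open import Data.List.Relation.Unary.All using (All)
open import Data.List.Relation.Unary.AllPairs using (AllPairs; allPairs?)
open import Data.List.Relation.Unary.Unique.Propositional using (Unique)
open import Data.Nat.Base using (ℕ; _*_; _∸_; _⊓_; _≤_; _/_)
open import Data.Product.Base using (Σ-syntax; ∃-syntax; _×_)
open import Function.Definitions using (Injective)
open import Relation.Binary.Definitions using (Decidable)
open import Relation.Binary.PropositionalEquality using (_≡_; _≢_)
open import Relation.Nullary using (¬_; ¬?)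

-- A finite ground set with n points is represented by Fin n; `Subset n` is a
-- vector of sides, so propositional equality of subsets is extensional.
record Family (n : ℕ) : Set where
  constructor family
  field
    members  : List (Subset n)
    distinct : Unique members

open Family public

size : ∀ {n} → Family n → ℕ
size F = length (members F)

Uniform : ∀ {n} → ℕ → Family n → Set
Uniform w F = All (λ A → ∣ A ∣ ≡ w) (members F)

IsSunflower : ∀ {n} (k : ℕ) → (Fin k → Subset n) → Set
IsSunflower {n} k A =
  Injective _≡_ _≡_ A ×
  (Σ[ C ∈ Subset n ] (∀ i j → i ≢ j → A i ∩ A j ≡ C))

ContainsSunflower : ∀ {n} → ℕ → Family n → Set
ContainsSunflower {n} k F =
  Σ[ A ∈ (Fin k → Subset n) ] (∀ i → A i ∈ members F) × IsSunflower k A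

Disjoint : ∀ {n} → Subset n → Subset n → Set
Disjoint A B = Empty (A ∩ B)

disjoint? : ∀ {n} → Decidable (Disjoint {n})
disjoint? A B = ¬? (nonempty? (A ∩ B))

sublists : ∀ {A : Set} → List A → List (List A)
sublists []       = [] ∷ []
sublists (x ∷ xs) = map (x ∷_) (sublists xs) ++ sublists xs

-- The matching number.  The members of F are distinct, so its sublists
-- enumerate its subfamilies; the empty subfamily makes the default 0 harmless.
ν : ∀ {n} → Family n → ℕ
ν F = max 0 (map length (filter (allPairs? disjoint?) (sublists (members F))))

-- s is the largest size of a family with property P, over all finite ground
-- sets.
IsMaxSize : (∀ {n} → Family n → Set) → ℕ → Set
IsMaxSize P s =
  (∃[ n ] Σ[ F ∈ Family n ] P F × size F ≡ s) ×
  (∀ {n} (F : Family n) → P F → size F ≤ s)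

-- The graphs of the functions f and ψ: `f[ w , k ]≡ s` says that the maximum
-- defining f(w,k) is s, and similarly for ψ(w,k,m).  There is at most one such
-- s, and for w ≥ 1 there is one by the Erdős–Rado sunflower lemma.
f[_,_]≡_ : ℕ → ℕ → ℕ → Set
f[ w , k ]≡ s = IsMaxSize (λ F → Uniform w F × ¬ ContainsSunflower k F) s

ψ[_,_,_]≡_ : ℕ → ℕ → ℕ → ℕ → Set
ψ[ w , k , m ]≡ s =
  IsMaxSize (λ F → Uniform w F × ¬ ContainsSunflower k F × ν F ≤ m ∸ 1) s

d : ℕ → ℕ → ℕ
d m k = (k ∸ m) ⊓ (m ∸ 1)

E : ℕ → ℕ → ℕ
E m k = (m * d m k) / 2

{-# OPTIONS --safe #-}

-- Take a graph G on m vertices with maximum degree at most d and ⌊md/2⌋ edges,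
-- an optimal family F for ψ(w-1,k,m) and an optimal family H for f(w-2,k), on
-- three disjoint ground sets.  Let K consist of all {v} ∪ A with v a vertex and
-- A ∈ F, and all e ∪ B with e an edge and B ∈ H.
--
-- m disjoint members of K would use one vertex each, hence be of the first kind
-- and give m disjoint members of F.  Suppose K contains a k-sunflower.  If its
-- core has no vertex, the k members use distinct vertices, so k ≤ m.  If the core
-- has two vertices, all members lie over one edge and H contains a k-sunflower.
-- If it has exactly one vertex and all members are of the first kind, F contains a
-- k-sunflower.  Otherwise the core has exactly one vertex and is disjoint from the
-- ground set of F, so at most d members are edge sets (they lie over distinct edges
-- at one vertex) and at most m-1 are vertex sets (their parts in F are disjoint),
-- whence k ≤ d + m - 1 < k.
--
-- G is the circulant graph on ℤ/m with steps 1, …, ⌊d/2⌋; for odd d the matching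
-- {i, i + ⌊m/2⌋}, i < ⌊m/2⌋, is added.

module Submission where

open import Defs
open import Data.Nat.Base using (ℕ; _+_; _*_; _∸_; _≤_; _≥_)

open import Data.Bool.Properties using () renaming (_≟_ to _≟ᵇ_)
import Data.Empty as Void
open import Data.Fin.Base using (Fin; zero; suc; toℕ)
open import Data.Fin.Properties using (toℕ-fromℕ<; toℕ-injective; toℕ<n; ¬∀⟶∃¬)
open import Data.Fin.Subset using (Subset; inside; outside; ⊥; ⁅_⁆; _∩_; _∪_; ∣_∣; Empty; ⋃)
  renaming (_∈_ to _∈ˢ_)
open import Data.Fin.Subset.Properties hiding (_∈?_)
open import Data.List.Base
  using (List; []; _∷_; _++_; [_]; map; filter; length; allFin; cartesianProductWith)
open import Data.List.Extrema.Nat using (max≤v⁺; xs≤max)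
open import Data.List.Membership.Propositional using (_∈_; find)
open import Data.List.Membership.Propositional.Properties
open import Data.List.Properties using (length-map; length-++; length-tabulate; length-++-sucʳ)
open import Data.List.Relation.Binary.Subset.Propositional using (_⊆_)
open import Data.List.Relation.Unary.All as All using (All; []; _∷_)
import Data.List.Relation.Unary.All.Properties as Allₚ
open import Data.List.Relation.Unary.AllPairs as AllPairs using (AllPairs; []; _∷_; allPairs?)
import Data.List.Relation.Unary.AllPairs.Properties as AllPairsₚ
open import Data.List.Relation.Unary.Any using (here; there)
open import Data.List.Relation.Unary.Unique.Propositional using (Unique)
import Data.List.Relation.Unary.Unique.Propositional.Properties as Uniqueₚ
open import Data.Nat.Base using (zero; suc; _/_; _%_; _<_; z≤n; s≤s; s≤s⁻¹; z<s)
open import Data.Nat.Divisibility using (n∣m*n)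
open import Data.Nat.DivMod
open import Data.Nat.ListAction using (sum)
open import Data.Nat.Properties
open import Data.Product.Base using (Σ-syntax; ∃-syntax; ∃₂; _×_; _,_; proj₁; proj₂; uncurry)
open import Data.Sum.Base using (_⊎_; inj₁; inj₂; [_,_]′)
open import Data.Vec.Base using (take; drop) renaming (_++_ to _⊕_; [] to []ᵛ; _∷_ to _∷ᵛ_)
import Data.Vec.Properties as Vecₚ
open import Function.Base using (_∘_; case_of_)
open import Relation.Binary.PropositionalEquality
  using (_≡_; _≢_; refl; sym; trans; cong; cong₂; subst; subst₂; module ≡-Reasoning)
open import Relation.Nullary using (¬_; ¬?; Dec; yes; no; contradiction)
open import Relation.Unary using () renaming (Decidable to Decidable₁)

private variable
  n : ℕ
  X Y Z : Set

-- Lists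

-- Pigeonhole without decidable equality: the head is cut out of `ys` at its position, and the tail,
-- which avoids it, still embeds in what is left.
Unique-⊆⇒length≤ : {xs ys : List X} → Unique xs → xs ⊆ ys → length xs ≤ length ys
Unique-⊆⇒length≤ []                          sub = z≤n
Unique-⊆⇒length≤ {xs = x ∷ xs} (x≢xs ∷ xs!) sub
  with ps , qs , refl ← ∈-∃++ (sub (here refl)) =
  subst (suc (length xs) ≤_) (sym (length-++-sucʳ ps x qs))
    (s≤s (Unique-⊆⇒length≤ xs! sub′))
  where
  sub′ : xs ⊆ ps ++ qs
  sub′ y∈xs with ∈-++⁻ ps (sub (there y∈xs))
  ... | inj₁ y∈ps         = ∈-++⁺ˡ y∈ps
  ... | inj₂ (here refl)  = contradiction refl (All.lookup x≢xs y∈xs)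
  ... | inj₂ (there y∈qs) = ∈-++⁺ʳ ps y∈qs

length-cartesianProductWith : (g : X → Y → Z) (xs : List X) (ys : List Y) →
  length (cartesianProductWith g xs ys) ≡ length xs * length ys
length-cartesianProductWith g []       ys = refl
length-cartesianProductWith g (x ∷ xs) ys =
  trans (length-++ (map (g x) ys))
    (cong₂ _+_ (length-map (g x) ys) (length-cartesianProductWith g xs ys))

length-allFin : ∀ k → length (allFin k) ≡ k
length-allFin k = length-tabulate {n = k} (λ i → i)

length-filter-¬ : {P : X → Set} (P? : Decidable₁ P) (xs : List X) →
  length xs ≡ length (filter P? xs) + length (filter (¬? ∘ P?) xs)
length-filter-¬ P? []       = refl
length-filter-¬ P? (x ∷ xs) with P? x
... | yes _ = cong suc (length-filter-¬ P? xs)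
... | no  _ = trans (cong suc (length-filter-¬ P? xs)) (sym (+-suc _ _))

-- `ν` ranges only over sublists in the order of `members`, so a subfamily is presented as a filter
-- in order to be counted.
filter∈sublists : {P : X → Set} (P? : Decidable₁ P) (xs : List X) → filter P? xs ∈ sublists xs
filter∈sublists P? []       = here refl
filter∈sublists P? (x ∷ xs) with P? x
... | yes _ = ∈-++⁺ˡ (∈-map⁺ (x ∷_) (filter∈sublists P? xs))
... | no  _ = ∈-++⁺ʳ (map (x ∷_) (sublists xs)) (filter∈sublists P? xs)

∈-sublists⇒⊆ : (xs : List X) {ys : List X} → ys ∈ sublists xs → ys ⊆ xs
∈-sublists⇒⊆ []       (here refl) ()
∈-sublists⇒⊆ (x ∷ xs) ys∈ with ∈-++⁻ (map (x ∷_) (sublists xs)) ys∈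
... | inj₂ ys∈xs = there ∘ ∈-sublists⇒⊆ xs ys∈xs
... | inj₁ ys∈x∷ with _ , zs∈ , refl ← ∈-map⁻ (x ∷_) ys∈x∷ =
  λ { (here eq) → here eq ; (there z∈) → there (∈-sublists⇒⊆ xs zs∈ z∈) }

-- Finite subsets

∣++∣ : ∀ {m n} (p : Subset m) (q : Subset n) → ∣ p ⊕ q ∣ ≡ ∣ p ∣ + ∣ q ∣
∣++∣ []ᵛ             q = refl
∣++∣ (inside  ∷ᵛ p) q = cong suc (∣++∣ p q)
∣++∣ (outside ∷ᵛ p) q = ∣++∣ p q

∣∪∣+∣∩∣ : (p q : Subset n) → ∣ p ∪ q ∣ + ∣ p ∩ q ∣ ≡ ∣ p ∣ + ∣ q ∣
∣∪∣+∣∩∣ []ᵛ             []ᵛ             = refl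
∣∪∣+∣∩∣ (outside ∷ᵛ p) (outside ∷ᵛ q) = ∣∪∣+∣∩∣ p q
∣∪∣+∣∩∣ (inside  ∷ᵛ p) (outside ∷ᵛ q) = cong suc (∣∪∣+∣∩∣ p q)
∣∪∣+∣∩∣ (outside ∷ᵛ p) (inside  ∷ᵛ q) = trans (cong suc (∣∪∣+∣∩∣ p q)) (sym (+-suc ∣ p ∣ ∣ q ∣))
∣∪∣+∣∩∣ (inside  ∷ᵛ p) (inside  ∷ᵛ q) =
  cong suc (trans (+-suc _ _) (trans (cong suc (∣∪∣+∣∩∣ p q)) (sym (+-suc ∣ p ∣ ∣ q ∣))))

Empty⇒∣∣≡0 : {p : Subset n} → Empty p → ∣ p ∣ ≡ 0
Empty⇒∣∣≡0 {n} ¬p = trans (cong ∣_∣ (Empty-unique ¬p)) (∣⊥∣≡0 n)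

x∈p⇒∣p∣>0 : {x : Fin n} {p : Subset n} → x ∈ˢ p → 0 < ∣ p ∣
x∈p⇒∣p∣>0 {x = x} {p} x∈p = subst (_≤ ∣ p ∣) (∣⁅x⁆∣≡1 x)
  (p⊆q⇒∣p∣≤∣q∣ λ y∈ → subst (_∈ˢ p) (sym (x∈⁅y⁆⇒x≡y x y∈)) x∈p)

∣∣≡0⇒Empty : {p : Subset n} → ∣ p ∣ ≡ 0 → Empty p
∣∣≡0⇒Empty eq (x , x∈p) = <⇒≢ (x∈p⇒∣p∣>0 x∈p) (sym eq)

∣p∩q∣≡∣p∣⇒p∩q≡p : (p q : Subset n) → ∣ p ∩ q ∣ ≡ ∣ p ∣ → p ∩ q ≡ p
∣p∩q∣≡∣p∣⇒p∩q≡p []ᵛ             []ᵛ             eq = refl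
∣p∩q∣≡∣p∣⇒p∩q≡p (outside ∷ᵛ p) (_       ∷ᵛ q) eq = cong (outside ∷ᵛ_) (∣p∩q∣≡∣p∣⇒p∩q≡p p q eq)
∣p∩q∣≡∣p∣⇒p∩q≡p (inside  ∷ᵛ p) (inside  ∷ᵛ q) eq =
  cong (inside ∷ᵛ_) (∣p∩q∣≡∣p∣⇒p∩q≡p p q (suc-injective eq))
∣p∩q∣≡∣p∣⇒p∩q≡p (inside  ∷ᵛ p) (outside ∷ᵛ q) eq =
  contradiction (∣p∩q∣≤∣p∣ p q) (<⇒≱ (≤-reflexive (sym eq)))

∣⊥∩p∣≡0 : (p : Subset n) → ∣ ⊥ ∩ p ∣ ≡ 0
∣⊥∩p∣≡0 {n} p = trans (cong ∣_∣ (∩-zeroˡ p)) (∣⊥∣≡0 n)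

Disjoint-sym : {p q : Subset n} → Disjoint p q → Disjoint q p
Disjoint-sym {p = p} {q} = subst Empty (∩-comm p q)

¬Disjoint-self : {p : Subset n} → 0 < ∣ p ∣ → ¬ Disjoint p p
¬Disjoint-self {p = p} ∣p∣>0 p∥p = <⇒≢ ∣p∣>0 (sym (trans (cong ∣_∣ (sym (∩-idem p))) (Empty⇒∣∣≡0 p∥p)))

Disjoint-⋃ : {p : Subset n} {qs : List (Subset n)} → All (Disjoint p) qs → Disjoint p (⋃ qs)
Disjoint-⋃ {p = p} [] (x , x∈) = ∉⊥ (proj₂ (x∈p∩q⁻ p ⊥ x∈))
Disjoint-⋃ {p = p} {q ∷ qs} (p∥q ∷ p∥qs) (x , x∈) with x∈p , x∈∪ ← x∈p∩q⁻ p (q ∪ ⋃ qs) x∈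
  with x∈p∪q⁻ q (⋃ qs) x∈∪
... | inj₁ x∈q  = p∥q (x , x∈p∩q⁺ (x∈p , x∈q))
... | inj₂ x∈qs = Disjoint-⋃ p∥qs (x , x∈p∩q⁺ (x∈p , x∈qs))

sum-disjoint : {qs : List (Subset n)} → AllPairs Disjoint qs → sum (map ∣_∣ qs) ≡ ∣ ⋃ qs ∣
sum-disjoint {n}                   []           = sym (∣⊥∣≡0 n)
sum-disjoint {n} {qs = q ∷ qs} (q∥ ∷ qs∥) = begin
  ∣ q ∣ + sum (map ∣_∣ qs)           ≡⟨ cong (∣ q ∣ +_) (sum-disjoint qs∥) ⟩
  ∣ q ∣ + ∣ ⋃ qs ∣                   ≡⟨ ∣∪∣+∣∩∣ q (⋃ qs) ⟨
  ∣ q ∪ ⋃ qs ∣ + ∣ q ∩ ⋃ qs ∣       ≡⟨ cong (∣ q ∪ ⋃ qs ∣ +_) (Empty⇒∣∣≡0 (Disjoint-⋃ q∥)) ⟩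
  ∣ q ∪ ⋃ qs ∣ + 0                   ≡⟨ +-identityʳ _ ⟩
  ∣ q ∪ ⋃ qs ∣                       ∎
  where open ≡-Reasoning

sum-disjoint≤ : {qs : List (Subset n)} → AllPairs Disjoint qs → sum (map ∣_∣ qs) ≤ n
sum-disjoint≤ {qs = qs} qs∥ = subst (_≤ _) (sym (sum-disjoint qs∥)) (∣p∣≤n (⋃ qs))

length≤sum : {qs : List (Subset n)} → All (λ q → 0 < ∣ q ∣) qs → length qs ≤ sum (map ∣_∣ qs)
length≤sum []         = z≤n
length≤sum (q>0 ∷ qs) = +-mono-≤ q>0 (length≤sum qs)

-- One set with two elements supplies the extra unit that makes the count strict.
length<sum : {q : Subset n} {qs : List (Subset n)} → All (λ q → 0 < ∣ q ∣) qs → q ∈ qs → 1 < ∣ q ∣ →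
  length qs < sum (map ∣_∣ qs)
length<sum (_   ∷ qs) (here refl) q>1 = +-mono-≤ q>1 (length≤sum qs)
length<sum (r>0 ∷ qs) (there q∈)  q>1 = +-mono-≤-< r>0 (length<sum qs q∈ q>1)

-- Matchings

ν≤ : (F : Family n) {b : ℕ} →
  (∀ {As} → As ⊆ members F → AllPairs Disjoint As → length As ≤ b) → ν F ≤ b
ν≤ F {b} bound = max≤v⁺ z≤n (Allₚ.map⁺ (All.tabulate λ As∈ →
  let As∈sub , As∥ = ∈-filter⁻ (allPairs? disjoint?) As∈
  in bound (∈-sublists⇒⊆ (members F) As∈sub) As∥))

AllPairs-lookup : {R : X → X → Set} → (∀ {x y} → R x y → R y x) → {xs : List X} → AllPairs R xs →
  ∀ {x y} → x ∈ xs → y ∈ xs → x ≢ y → R x y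
AllPairs-lookup R-sym (x∼ ∷ xs∼) (here refl) (here refl) x≢y = contradiction refl x≢y
AllPairs-lookup R-sym (x∼ ∷ xs∼) (here refl) (there y∈)  x≢y = All.lookup x∼ y∈
AllPairs-lookup R-sym (x∼ ∷ xs∼) (there x∈)  (here refl) x≢y = R-sym (All.lookup x∼ x∈)
AllPairs-lookup R-sym (x∼ ∷ xs∼) (there x∈)  (there y∈)  x≢y = AllPairs-lookup R-sym xs∼ x∈ y∈ x≢y

AllPairs-irrefl⇒Unique : {R : X → X → Set} {xs : List X} → All (λ x → ¬ R x x) xs → AllPairs R xs → Unique xs
AllPairs-irrefl⇒Unique []         []         = []
AllPairs-irrefl⇒Unique (¬r ∷ ¬rs) (r ∷ rs) =
  All.map (λ { r refl → ¬r r }) r ∷ AllPairs-irrefl⇒Unique ¬rs rs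

Unique⇒AllPairs : {R : X → X → Set} {xs : List X} →
  (∀ {x y} → x ∈ xs → y ∈ xs → x ≢ y → R x y) → Unique xs → AllPairs R xs
Unique⇒AllPairs r []          = []
Unique⇒AllPairs r (x≢ ∷ xs!) =
  All.tabulate (λ y∈ → r (here refl) (there y∈) (All.lookup x≢ y∈))
  ∷ Unique⇒AllPairs (λ x∈ y∈ → r (there x∈) (there y∈)) xs!

-- `As` may come in any order, so it is replaced by `Bs`, the members of `F` that occur in it.
-- Nonemptiness makes disjoint entries distinct, as the pigeonhole bound requires: copies of the
-- empty set would be pairwise disjoint.
length≤ν : (F : Family n) {As : List (Subset n)} → As ⊆ members F → All (λ A → 0 < ∣ A ∣) As →
  AllPairs Disjoint As → length As ≤ ν F
length≤ν F {As} As⊆F As>0 As∥ = ≤-trans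
  (Unique-⊆⇒length≤ (AllPairs-irrefl⇒Unique (All.map ¬Disjoint-self As>0) As∥)
    (λ A∈ → ∈-filter⁺ inAs? (As⊆F A∈) A∈))
  (All.lookup (xs≤max 0 _) (∈-map⁺ length (∈-filter⁺ (allPairs? disjoint?)
    (filter∈sublists inAs? (members F)) Bs∥)))
  where
  open import Data.List.Membership.DecPropositional (Vecₚ.≡-dec _≟ᵇ_) using (_∈?_)
  inAs? = _∈? As
  Bs = filter inAs? (members F)
  Bs∥ : AllPairs Disjoint Bs
  Bs∥ = Unique⇒AllPairs
    (λ A∈ B∈ → AllPairs-lookup Disjoint-sym As∥
      (proj₂ (∈-filter⁻ inAs? {xs = members F} A∈)) (proj₂ (∈-filter⁻ inAs? {xs = members F} B∈)))
    (Uniqueₚ.filter⁺ inAs? (distinct F))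

-- Near-regular graphs

-- Listing candidates for the edges at v, possibly with repetitions, spares
-- counting the edges at v exactly.
MaxDegree≤ : ∀ {m} → ℕ → List (Subset m) → Set
MaxDegree≤ {m} d es =
  (v : Fin m) → Σ[ star ∈ List (Subset m) ] length star ≤ d × (∀ {e} → e ∈ es → v ∈ˢ e → e ∈ star)

-- Congruence modulo `m`, and edges given by a start and a step.

module Circulant (m′ : ℕ) where

  m : ℕ
  m = suc m′

  -- Wrapped in a record so that both representatives can be inferred from the type.
  infix 4 _∼_
  record _∼_ (a b : ℕ) : Set where
    constructor %≡⇒∼
    field ∼⇒%≡ : a % m ≡ b % m
  open _∼_

  ∼-sym : ∀ {a b} → a ∼ b → b ∼ a
  ∼-sym (%≡⇒∼ p) = %≡⇒∼ (sym p)

  ∼-trans : ∀ {a b c} → a ∼ b → b ∼ c → a ∼ c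
  ∼-trans (%≡⇒∼ p) (%≡⇒∼ q) = %≡⇒∼ (trans p q)

  +-∼ : ∀ {a b} c → a ∼ b → a + c ∼ b + c
  +-∼ {a} {b} c (%≡⇒∼ a∼b) = %≡⇒∼ (begin
    (a + c) % m           ≡⟨ %-distribˡ-+ a c m ⟩
    (a % m + c % m) % m   ≡⟨ cong (λ r → (r + c % m) % m) a∼b ⟩
    (b % m + c % m) % m   ≡⟨ %-distribˡ-+ b c m ⟨
    (b + c) % m           ∎)
    where open ≡-Reasoning

  -- Adding `c * m′` undoes adding `c`, since the two sum to the multiple `c * m`; this avoids
  -- truncated subtraction.
  +-∼-cancelʳ : ∀ {a b} c → a + c ∼ b + c → a ∼ b
  +-∼-cancelʳ {a} {b} c a+c∼b+c =
    ∼-trans (∼-sym (strip a)) (∼-trans (+-∼ (c * m′) a+c∼b+c) (strip b))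
    where
    strip : ∀ x → x + c + c * m′ ∼ x
    strip x = %≡⇒∼ (trans
      (cong (_% m) (trans (+-assoc x c (c * m′)) (cong (x +_) (sym (*-suc c m′)))))
      ([m+kn]%n≡m%n x c m))

  +-∼-cancelˡ : ∀ {a b} c → c + a ∼ c + b → a ∼ b
  +-∼-cancelˡ {a} {b} c p = +-∼-cancelʳ c (subst₂ _∼_ (+-comm c a) (+-comm c b) p)

  ∼⇒≡ : ∀ {a b} → a < m → b < m → a ∼ b → a ≡ b
  ∼⇒≡ a<m b<m (%≡⇒∼ a∼b) = trans (sym (m<n⇒m%n≡m a<m)) (trans a∼b (m<n⇒m%n≡m b<m))

  x≁x+s : ∀ x {s} → 0 < s → s < m → ¬ (x ∼ x + s)
  x≁x+s x {s} 0<s s<m p = <⇒≢ 0<s (∼⇒≡ z<s s<m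
    (+-∼-cancelˡ x (subst (_∼ x + s) (sym (+-identityʳ x)) p)))

  mod⇒∼ : ∀ {a b} → a mod m ≡ b mod m → a ∼ b
  mod⇒∼ {a} {b} eq = %≡⇒∼ (subst₂ _≡_ (toℕ-fromℕ< (m%n<n a m)) (toℕ-fromℕ< (m%n<n b m)) (cong toℕ eq))

  ∼⇒mod : ∀ {a b} → a ∼ b → a mod m ≡ b mod m
  ∼⇒mod {a} {b} (%≡⇒∼ a∼b) = toℕ-injective
    (subst₂ _≡_ (sym (toℕ-fromℕ< (m%n<n a m))) (sym (toℕ-fromℕ< (m%n<n b m))) a∼b)

  toℕ-mod : (v : Fin m) → toℕ v mod m ≡ v
  toℕ-mod v = toℕ-injective (trans (toℕ-fromℕ< (m%n<n (toℕ v) m)) (m<n⇒m%n≡m (toℕ<n v)))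

  -- For a step divisible by `m` this degenerates to a single vertex, whence the bounds `0 < s` and
  -- `s < m` below.
  edge : ℕ → ℕ → Subset m
  edge a s = ⁅ a mod m ⁆ ∪ ⁅ (a + s) mod m ⁆

  edge-cong : ∀ {a b} s → a ∼ b → edge a s ≡ edge b s
  edge-cong s a∼b = cong₂ (λ u v → ⁅ u ⁆ ∪ ⁅ v ⁆) (∼⇒mod a∼b) (∼⇒mod (+-∼ s a∼b))

  ∣edge∣≡2 : ∀ a {s} → 0 < s → s < m → ∣ edge a s ∣ ≡ 2
  ∣edge∣≡2 a {s} 0<s s<m = begin
    ∣ u ∪ v ∣               ≡⟨ +-identityʳ _ ⟨
    ∣ u ∪ v ∣ + 0           ≡⟨ cong (∣ u ∪ v ∣ +_) (Empty⇒∣∣≡0 u∥v) ⟨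
    ∣ u ∪ v ∣ + ∣ u ∩ v ∣   ≡⟨ ∣∪∣+∣∩∣ u v ⟩
    ∣ u ∣ + ∣ v ∣           ≡⟨ cong₂ _+_ (∣⁅x⁆∣≡1 (a mod m)) (∣⁅x⁆∣≡1 ((a + s) mod m)) ⟩
    2                       ∎
    where
    open ≡-Reasoning
    u = ⁅ a mod m ⁆
    v = ⁅ (a + s) mod m ⁆
    u∥v : Disjoint u v
    u∥v (x , x∈) with x∈u , x∈v ← x∈p∩q⁻ u v x∈ =
      x≁x+s a 0<s s<m (mod⇒∼ (trans (sym (x∈⁅y⁆⇒x≡y (a mod m) x∈u)) (x∈⁅y⁆⇒x≡y ((a + s) mod m) x∈v)))

  ∈-edge⁻ : ∀ a s x → (x mod m) ∈ˢ edge a s → x ∼ a ⊎ x ∼ a + s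
  ∈-edge⁻ a s x x∈ with x∈p∪q⁻ ⁅ a mod m ⁆ ⁅ (a + s) mod m ⁆ x∈
  ... | inj₁ x∈u = inj₁ (mod⇒∼ (x∈⁅y⁆⇒x≡y (a mod m) x∈u))
  ... | inj₂ x∈v = inj₂ (mod⇒∼ (x∈⁅y⁆⇒x≡y ((a + s) mod m) x∈v))

  -- The endpoints match in the same or in the reversed order. If both matched one endpoint, `a` and
  -- `a + s` would be congruent.
  edge-injective : ∀ a b s t → 0 < s → s < m → edge a s ≡ edge b t →
    (a ∼ b × a + s ∼ b + t) ⊎ (a ∼ b + t × a + s ∼ b)
  edge-injective a b s t 0<s s<m eq
    with ∈-edge⁻ b t a (subst (a mod m ∈ˢ_) eq (x∈p∪q⁺ (inj₁ (x∈⁅x⁆ (a mod m)))))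
       | ∈-edge⁻ b t (a + s) (subst ((a + s) mod m ∈ˢ_) eq (x∈p∪q⁺ {p = ⁅ a mod m ⁆} (inj₂ (x∈⁅x⁆ ((a + s) mod m)))))
  ... | inj₁ a∼b   | inj₂ a+s∼b+t = inj₁ (a∼b , a+s∼b+t)
  ... | inj₂ a∼b+t | inj₁ a+s∼b   = inj₂ (a∼b+t , a+s∼b)
  ... | inj₁ a∼b   | inj₁ a+s∼b   = contradiction (∼-trans a∼b (∼-sym a+s∼b)) (x≁x+s a 0<s s<m)
  ... | inj₂ a∼b+t | inj₂ a+s∼b+t = contradiction (∼-trans a∼b+t (∼-sym a+s∼b+t)) (x≁x+s a 0<s s<m)

  -- A reversed match would give `b ∼ b + (s + t)`, which `0 < s + t < m` rules out. For this reason
  -- the steps of the circulant stay below `m` divided by 2.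
  edge-unique : ∀ {a b s t} → a < m → b < m → 0 < s → s + t < m → edge a s ≡ edge b t → a ≡ b × s ≡ t
  edge-unique {a} {b} {s} {t} a<m b<m 0<s s+t<m eq
    with edge-injective a b s t 0<s (≤-<-trans (m≤m+n s t) s+t<m) eq
  ... | inj₁ (a∼b , a+s∼b+t) = ∼⇒≡ a<m b<m a∼b ,
    ∼⇒≡ (≤-<-trans (m≤m+n s t) s+t<m) (≤-<-trans (m≤n+m t s) s+t<m)
      (+-∼-cancelˡ b (∼-trans (+-∼ s (∼-sym a∼b)) a+s∼b+t))
  ... | inj₂ (a∼b+t , a+s∼b) = contradiction
    (subst (b ∼_) (trans (+-assoc b t s) (cong (b +_) (+-comm t s)))
      (∼-trans (∼-sym a+s∼b) (+-∼ s a∼b+t)))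
    (x≁x+s b (≤-trans 0<s (m≤m+n s t)) s+t<m)

  -- The vertex is the start or the end of the edge. In the second case the start is `v` minus `s`,
  -- written with `m ∸ s` to stay in the natural numbers.
  edge-star : (v : Fin m) (a : ℕ) {s : ℕ} → s ≤ m → v ∈ˢ edge a s →
    edge a s ≡ edge (toℕ v) s ⊎ edge a s ≡ edge (toℕ v + (m ∸ s)) s
  edge-star v a {s} s≤m v∈ with ∈-edge⁻ a s (toℕ v) (subst (_∈ˢ edge a s) (sym (toℕ-mod v)) v∈)
  ... | inj₁ v∼a   = inj₁ (edge-cong s (∼-sym v∼a))
  ... | inj₂ v∼a+s = inj₂ (edge-cong s (∼-trans (∼-sym a+m∼a) (∼-sym (+-∼ (m ∸ s) v∼a+s))))
    where
    a+m∼a : a + s + (m ∸ s) ∼ a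
    a+m∼a = %≡⇒∼ (trans
      (cong (_% m) (trans (+-assoc a s (m ∸ s)) (cong (a +_) (m+[n∸m]≡n s≤m))))
      ([m+n]%n≡m%n a m))

  -- The circulant graph.

  module Steps (c : ℕ) (2c<m : c + c < m) where

    step≤ : (s : Fin c) → suc (toℕ s) ≤ c
    step≤ = toℕ<n

    step<m : (s : Fin c) → suc (toℕ s) < m
    step<m s = ≤-<-trans (≤-trans (step≤ s) (m≤m+n c c)) 2c<m

    -- The index `s` stands for the step `suc (toℕ s)`, so the steps run from 1 to `c`.
    circulantEdge : Fin c → Fin m → Subset m
    circulantEdge s i = edge (toℕ i) (suc (toℕ s))

    circulant : List (Subset m)
    circulant = cartesianProductWith circulantEdge (allFin c) (allFin m)

    length-circulant : length circulant ≡ c * m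
    length-circulant = trans (length-cartesianProductWith circulantEdge (allFin c) (allFin m))
      (cong₂ _*_ (length-allFin c) (length-allFin m))

    circulant-unique : Unique circulant
    circulant-unique = Uniqueₚ.cartesianProductWith⁺ circulantEdge inj (Uniqueₚ.allFin⁺ c) (Uniqueₚ.allFin⁺ m)
      where
      inj : ∀ {s t i j} → circulantEdge s i ≡ circulantEdge t j → s ≡ t × i ≡ j
      inj {s} {t} {i} {j} eq
        with i≡j , s≡t ← edge-unique (toℕ<n i) (toℕ<n j) z<s (≤-<-trans (+-mono-≤ (step≤ s) (step≤ t)) 2c<m) eq =
        toℕ-injective (suc-injective s≡t) , toℕ-injective i≡j

    ∈-circulant⁻ : ∀ {e} → e ∈ circulant → ∃₂ λ s i → e ≡ circulantEdge s i
    ∈-circulant⁻ e∈ with s , i , _ , _ , eq ← ∈-cartesianProductWith⁻ circulantEdge (allFin c) (allFin m) e∈ =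
      s , i , eq

    circulant-2-uniform : All (λ e → ∣ e ∣ ≡ 2) circulant
    circulant-2-uniform = All.tabulate λ e∈ → case ∈-circulant⁻ e∈ of
      λ { (s , i , refl) → ∣edge∣≡2 (toℕ i) z<s (step<m s) }

    -- Each step contributes one edge that starts at `v` and one that ends there.
    circulant-degree : MaxDegree≤ (c + c) circulant
    circulant-degree v = map out (allFin c) ++ map inn (allFin c) , ≤-reflexive len , covers
      where
      out inn : Fin c → Subset m
      out s = edge (toℕ v) (suc (toℕ s))
      inn s = edge (toℕ v + (m ∸ suc (toℕ s))) (suc (toℕ s))
      len : length (map out (allFin c) ++ map inn (allFin c)) ≡ c + c
      len = trans (length-++ (map out (allFin c)))
        (cong₂ _+_ (trans (length-map out (allFin c)) (length-allFin c))
                   (trans (length-map inn (allFin c)) (length-allFin c)))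
      covers : ∀ {e} → e ∈ circulant → v ∈ˢ e → e ∈ map out (allFin c) ++ map inn (allFin c)
      covers e∈ v∈e with s , i , refl ← ∈-circulant⁻ e∈ with edge-star v (toℕ i) (<⇒≤ (step<m s)) v∈e
      ... | inj₁ eq = ∈-++⁺ˡ (subst (_∈ _) (sym eq) (∈-map⁺ out (∈-allFin s)))
      ... | inj₂ eq = ∈-++⁺ʳ (map out (allFin c)) (subst (_∈ _) (sym eq) (∈-map⁺ inn (∈-allFin s)))

  -- The matching with step `h`.

  h : ℕ
  h = m / 2

  h+h≤m : h + h ≤ m
  h+h≤m = subst (_≤ m) (trans (*-comm h 2) (cong (h +_) (+-identityʳ h))) (m/n*n≤m m 2)

  i+h<m : (i : Fin h) → toℕ i + h < m
  i+h<m i = <-≤-trans (+-monoˡ-< h (toℕ<n i)) h+h≤m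

  i<m : (i : Fin h) → toℕ i < m
  i<m i = ≤-<-trans (m≤m+n (toℕ i) h) (i+h<m i)

  0<h : Fin h → 0 < h
  0<h i = ≤-<-trans z≤n (toℕ<n i)

  h<m : Fin h → h < m
  h<m i = ≤-<-trans (m≤n+m h (toℕ i)) (i+h<m i)

  halfEdge : Fin h → Subset m
  halfEdge i = edge (toℕ i) h

  halfMatching : List (Subset m)
  halfMatching = map halfEdge (allFin h)

  length-halfMatching : length halfMatching ≡ h
  length-halfMatching = trans (length-map halfEdge (allFin h)) (length-allFin h)

  -- Starts lie below `h` and ends at or above it, all below `m`, so a start never coincides with an
  -- end.
  halfMatching-unique : Unique halfMatching
  halfMatching-unique = Uniqueₚ.map⁺ (λ {i} {j} → inj i j) (Uniqueₚ.allFin⁺ h)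
    where
    inj : ∀ i j → halfEdge i ≡ halfEdge j → i ≡ j
    inj i j eq with edge-injective (toℕ i) (toℕ j) h h (0<h i) (h<m i) eq
    ... | inj₁ (i∼j , _)   = toℕ-injective (∼⇒≡ (i<m i) (i<m j) i∼j)
    ... | inj₂ (i∼j+h , _) = contradiction
      (subst (h ≤_) (sym (∼⇒≡ (i<m i) (i+h<m j) i∼j+h)) (m≤n+m h (toℕ j)))
      (<⇒≱ (toℕ<n i))

  ∈-halfMatching⁻ : ∀ {e} → e ∈ halfMatching → ∃[ i ] e ≡ halfEdge i
  ∈-halfMatching⁻ e∈ with i , _ , eq ← ∈-map⁻ halfEdge e∈ = i , eq

  halfMatching-2-uniform : All (λ e → ∣ e ∣ ≡ 2) halfMatching
  halfMatching-2-uniform = All.tabulate λ e∈ → case ∈-halfMatching⁻ e∈ of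
    λ { (i , refl) → ∣edge∣≡2 (toℕ i) (0<h i) (h<m i) }

  halfMatching-degree : MaxDegree≤ 1 halfMatching
  halfMatching-degree v = [ mate ] , ≤-refl , λ e∈ v∈e → here (covers e∈ v∈e)
    where
    start : Dec (toℕ v < h) → ℕ
    start (yes _) = toℕ v
    -- For odd `m` the last vertex is unmatched; its `mate` is then a candidate outside the
    -- matching, which an upper bound on the degree allows.
    start (no  _) = toℕ v ∸ h
    mate : Subset m
    mate = edge (start (toℕ v <? h)) h
    covers : ∀ {e} → e ∈ halfMatching → v ∈ˢ e → e ≡ mate
    covers e∈ v∈e with i , refl ← ∈-halfMatching⁻ e∈
      with ∈-edge⁻ (toℕ i) h (toℕ v) (subst (_∈ˢ _) (sym (toℕ-mod v)) v∈e) | toℕ v <? h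
    ... | inj₁ v∼i   | yes _   = edge-cong h (∼-sym v∼i)
    ... | inj₁ v∼i   | no v≮h  = contradiction
      (subst (_< h) (sym (∼⇒≡ (toℕ<n v) (i<m i) v∼i)) (toℕ<n i)) v≮h
    ... | inj₂ v∼i+h | yes v<h = contradiction
      (subst (h ≤_) (sym (∼⇒≡ (toℕ<n v) (i+h<m i) v∼i+h)) (m≤n+m h (toℕ i))) (<⇒≱ v<h)
    ... | inj₂ v∼i+h | no _    = cong (λ a → edge a h)
      (trans (sym (m+n∸n≡m (toℕ i) h)) (cong (_∸ h) (sym (∼⇒≡ (toℕ<n v) (i+h<m i) v∼i+h))))

-- Combining the circulant and the matching.

MaxDegree≤-++ : ∀ {m d d′} {es es′ : List (Subset m)} →
  MaxDegree≤ d es → MaxDegree≤ d′ es′ → MaxDegree≤ (d + d′) (es ++ es′)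
MaxDegree≤-++ {es = es} deg deg′ v
  with star , len , covers ← deg v | star′ , len′ , covers′ ← deg′ v =
  star ++ star′ , ≤-trans (≤-reflexive (length-++ star)) (+-mono-≤ len len′) ,
  λ e∈ v∈e → [ (λ e∈es → ∈-++⁺ˡ (covers e∈es v∈e)) , (λ e∈es′ → ∈-++⁺ʳ star (covers′ e∈es′ v∈e)) ]′ (∈-++⁻ es e∈)

data Parity : ℕ → Set where
  even : ∀ c → Parity (c + c)
  odd  : ∀ c → Parity (c + c + 1)

parity : ∀ d → Parity d
parity zero = even 0
parity (suc d) with parity d
... | even c = subst Parity (+-comm (c + c) 1) (odd c)
... | odd  c = subst Parity (cong suc (trans (+-suc c c) (+-comm 1 (c + c)))) (even (suc c))

c+c≡c*2 : ∀ c → c + c ≡ c * 2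
c+c≡c*2 c = trans (cong (c +_) (sym (+-identityʳ c))) (*-comm 2 c)

m[c+c]≡cm*2 : ∀ m c → m * (c + c) ≡ c * m * 2
m[c+c]≡cm*2 m c = begin
  m * (c + c)   ≡⟨ cong (m *_) (c+c≡c*2 c) ⟩
  m * (c * 2)   ≡⟨ *-assoc m c 2 ⟨
  m * c * 2     ≡⟨ cong (_* 2) (*-comm m c) ⟩
  c * m * 2     ∎
  where open ≡-Reasoning

-- For `d = 2c` the circulant alone has `c * m` edges, exactly half of `m * d`. For `d = 2c + 1` the
-- matching adds the missing floor of `m / 2` edges and one to the degree.
nearRegularGraph : ∀ m d → d < m →
  Σ[ G ∈ Family m ] Uniform 2 G × MaxDegree≤ d (members G) × size G ≡ (m * d) / 2
nearRegularGraph (suc m′) d d<m with parity d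
... | even c = family (circulant) (circulant-unique) , circulant-2-uniform , circulant-degree ,
  trans (length-circulant) (sym (trans (cong (_/ 2) (m[c+c]≡cm*2 m c)) (m*n/n≡m (c * m) 2)))
  where
  open Circulant m′
  open Steps c d<m
... | odd c =
  family (circulant ++ halfMatching) (Uniqueₚ.++⁺ (circulant-unique) halfMatching-unique (uncurry disjoint)) ,
  Allₚ.++⁺ (circulant-2-uniform) halfMatching-2-uniform ,
  MaxDegree≤-++ (circulant-degree) halfMatching-degree ,
  (begin
    length (circulant ++ halfMatching)  ≡⟨ length-++ (circulant) ⟩
    length (circulant) + length halfMatching
                                       ≡⟨ cong₂ _+_ (length-circulant) length-halfMatching ⟩
    c * m + m / 2                      ≡⟨ cong (_+ m / 2) (m*n/n≡m (c * m) 2) ⟨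
    -- The floor is additive here because the first summand is even.
    (c * m * 2) / 2 + m / 2            ≡⟨ +-distrib-/-∣ˡ m (n∣m*n (c * m)) ⟨
    (c * m * 2 + m) / 2                ≡⟨ cong (_/ 2) (cong₂ _+_ (m[c+c]≡cm*2 m c) (*-identityʳ m)) ⟨
    (m * (c + c) + m * 1) / 2          ≡⟨ cong (_/ 2) (*-distribˡ-+ m (c + c) 1) ⟨
    (m * (c + c + 1)) / 2              ∎)
  where
  open Circulant m′
  open ≡-Reasoning
  2c<m : c + c < m
  2c<m = ≤-<-trans (m≤m+n (c + c) 1) d<m
  open Steps c 2c<m
  -- In the odd case `d < m` reads `2c + 2 ≤ m`; halving leaves the step `h` larger than every step
  -- of the circulant.
  c<h : c < h
  c<h = subst (_≤ h) (m*n/n≡m (suc c) 2) (/-monoˡ-≤ 2 (subst (_≤ m) eq d<m))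
    where
    eq : suc (c + c + 1) ≡ suc c * 2
    eq = trans (cong suc (+-comm (c + c) 1)) (cong (λ x → suc (suc x)) (c+c≡c*2 c))
  disjoint : ∀ {e} → e ∈ circulant → ¬ (e ∈ halfMatching)
  disjoint e∈ e∈′ with s , i , e≡c ← ∈-circulant⁻ e∈ | j , e≡h ← ∈-halfMatching⁻ e∈′ =
    <⇒≢ s<h (proj₂ (edge-unique (toℕ<n i) (i<m j) z<s (<-≤-trans (+-monoˡ-< h s<h) h+h≤m) (trans (sym e≡c) e≡h)))
    where
    s<h : suc (toℕ s) < h
    s<h = ≤-<-trans (toℕ<n s) c<h

-- The family K

another : ∀ {k} → 2 ≤ k → (i : Fin k) → ∃[ j ] i ≢ j
another (s≤s (s≤s _)) zero    = suc zero , λ ()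
another (s≤s (s≤s _)) (suc i) = zero , λ ()

-- `w` is two less than the uniformity of `K`, so `F` plays the optimal family for ψ and `H` the one
-- for f.
module Construction
  {m n₁ n₂ : ℕ} (G : Family m) (F : Family n₁) (H : Family n₂) {w : ℕ}
  (∣G∣≡2 : Uniform 2 G) (∣F∣≡1+w : Uniform (suc w) F) (∣H∣≡w : Uniform w H)
  where

  vertexSet : Fin m → Subset n₁ → Subset (m + (n₁ + n₂))
  vertexSet v A = ⁅ v ⁆ ⊕ (A ⊕ ⊥)

  edgeSet : Subset m → Subset n₂ → Subset (m + (n₁ + n₂))
  edgeSet e B = e ⊕ (⊥ ⊕ B)

  vertexSets edgeSets : List (Subset (m + (n₁ + n₂)))
  vertexSets = cartesianProductWith vertexSet (allFin m) (members F)
  edgeSets   = cartesianProductWith edgeSet (members G) (members H)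

  -- `τ`, `α` and `β` are the traces on the vertices of the graph, on the ground set of `F` and on
  -- that of `H`.
  τ : Subset (m + (n₁ + n₂)) → Subset m
  τ = take m

  α : Subset (m + (n₁ + n₂)) → Subset n₁
  α = take n₁ ∘ drop m

  β : Subset (m + (n₁ + n₂)) → Subset n₂
  β = drop n₁ ∘ drop m

  parts : ∀ S → τ S ⊕ (α S ⊕ β S) ≡ S
  parts S = trans (cong (τ S ⊕_) (Vecₚ.take++drop≡id n₁ (drop m S))) (Vecₚ.take++drop≡id m S)

  parts-injective : ∀ {S S′} → τ S ≡ τ S′ → α S ≡ α S′ → β S ≡ β S′ → S ≡ S′
  parts-injective {S} {S′} p q r = trans (sym (parts S))
    (trans (cong₂ _⊕_ p (cong₂ _⊕_ q r)) (parts S′))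

  τ-⊕ : (p : Subset m) (q : Subset n₁) (r : Subset n₂) → τ (p ⊕ (q ⊕ r)) ≡ p
  τ-⊕ p q r = Vecₚ.++-injectiveˡ _ p (Vecₚ.take++drop≡id m (p ⊕ (q ⊕ r)))

  drop-⊕ : (p : Subset m) (q : Subset n₁) (r : Subset n₂) → drop m (p ⊕ (q ⊕ r)) ≡ q ⊕ r
  drop-⊕ p q r = Vecₚ.++-injectiveʳ _ p (Vecₚ.take++drop≡id m (p ⊕ (q ⊕ r)))

  α-⊕ : (p : Subset m) (q : Subset n₁) (r : Subset n₂) → α (p ⊕ (q ⊕ r)) ≡ q
  α-⊕ p q r = trans (cong (take n₁) (drop-⊕ p q r)) (Vecₚ.++-injectiveˡ _ q (Vecₚ.take++drop≡id n₁ (q ⊕ r)))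

  β-⊕ : (p : Subset m) (q : Subset n₁) (r : Subset n₂) → β (p ⊕ (q ⊕ r)) ≡ r
  β-⊕ p q r = trans (cong (drop n₁) (drop-⊕ p q r)) (Vecₚ.++-injectiveʳ _ q (Vecₚ.take++drop≡id n₁ (q ⊕ r)))

  τ-∩ : ∀ S S′ → τ (S ∩ S′) ≡ τ S ∩ τ S′
  τ-∩ = Vecₚ.take-zipWith {m = m} _

  α-∩ : ∀ S S′ → α (S ∩ S′) ≡ α S ∩ α S′
  α-∩ S S′ = trans (cong (take n₁) (Vecₚ.drop-zipWith {m = m} _ S S′))
    (Vecₚ.take-zipWith {m = n₁} _ (drop m S) (drop m S′))

  β-∩ : ∀ S S′ → β (S ∩ S′) ≡ β S ∩ β S′
  β-∩ S S′ = trans (cong (drop n₁) (Vecₚ.drop-zipWith {m = m} _ S S′))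
    (Vecₚ.drop-zipWith {m = n₁} _ (drop m S) (drop m S′))

  ∣parts∣ : ∀ S → ∣ S ∣ ≡ ∣ τ S ∣ + (∣ α S ∣ + ∣ β S ∣)
  ∣parts∣ S = trans (cong ∣_∣ (sym (parts S)))
    (trans (∣++∣ (τ S) (α S ⊕ β S)) (cong (∣ τ S ∣ +_) (∣++∣ (α S) (β S))))

  τ-Disjoint : ∀ {S S′} → Disjoint S S′ → Disjoint (τ S) (τ S′)
  τ-Disjoint {S} {S′} S∥S′ = ∣∣≡0⇒Empty (subst (λ p → ∣ p ∣ ≡ 0) (τ-∩ S S′)
    (m+n≡0⇒m≡0 _ (trans (sym (∣parts∣ (S ∩ S′))) (Empty⇒∣∣≡0 S∥S′))))

  α-Disjoint : ∀ {S S′} → Disjoint S S′ → Disjoint (α S) (α S′)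
  α-Disjoint {S} {S′} S∥S′ = ∣∣≡0⇒Empty (subst (λ p → ∣ p ∣ ≡ 0) (α-∩ S S′)
    (m+n≡0⇒m≡0 _ (m+n≡0⇒n≡0 ∣ τ (S ∩ S′) ∣ (trans (sym (∣parts∣ (S ∩ S′))) (Empty⇒∣∣≡0 S∥S′)))))

  -- Phrased through traces only, so that the decidable test whether `τ S` is a singleton determines
  -- the kind.
  data Kind (S : Subset (m + (n₁ + n₂))) : Set where
    vertex : ∣ τ S ∣ ≡ 1 → α S ∈ members F → β S ≡ ⊥ → Kind S
    edge   : ∣ τ S ∣ ≡ 2 → τ S ∈ members G → α S ≡ ⊥ → β S ∈ members H → Kind S

  kind : ∀ {S} → S ∈ vertexSets ++ edgeSets → Kind S
  kind S∈ with ∈-++⁻ vertexSets S∈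
  ... | inj₁ S∈v with v , A , _ , A∈F , refl ← ∈-cartesianProductWith⁻ vertexSet (allFin m) (members F) S∈v =
    vertex (trans (cong ∣_∣ (τ-⊕ ⁅ v ⁆ A ⊥)) (∣⁅x⁆∣≡1 v))
      (subst (_∈ members F) (sym (α-⊕ ⁅ v ⁆ A ⊥)) A∈F) (β-⊕ ⁅ v ⁆ A ⊥)
  ... | inj₂ S∈e with e , B , e∈G , B∈H , refl ← ∈-cartesianProductWith⁻ edgeSet (members G) (members H) S∈e =
    edge (trans (cong ∣_∣ (τ-⊕ e ⊥ B)) (All.lookup ∣G∣≡2 e∈G)) (subst (_∈ members G) (sym (τ-⊕ e ⊥ B)) e∈G)
      (α-⊕ e ⊥ B) (subst (_∈ members H) (sym (β-⊕ e ⊥ B)) B∈H)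

  kind-∣τ∣>0 : ∀ {S} → Kind S → 0 < ∣ τ S ∣
  kind-∣τ∣>0 (vertex τ≡1 _ _) = ≤-reflexive (sym τ≡1)
  kind-∣τ∣>0 (edge τ≡2 _ _ _) = subst (0 <_) (sym τ≡2) z<s

  kind-∣τ∣≤2 : ∀ {S} → Kind S → ∣ τ S ∣ ≤ 2
  kind-∣τ∣≤2 (vertex τ≡1 _ _) = subst (_≤ 2) (sym τ≡1) (s≤s z≤n)
  kind-∣τ∣≤2 (edge τ≡2 _ _ _) = ≤-reflexive τ≡2

  kind-vertex : ∀ {S} → Kind S → ∣ τ S ∣ ≡ 1 → α S ∈ members F × β S ≡ ⊥
  kind-vertex (vertex _ A∈F β≡⊥) _   = A∈F , β≡⊥
  kind-vertex (edge τ≡2 _ _ _)   τ≡1 = case trans (sym τ≡1) τ≡2 of λ ()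

  kind-edge : ∀ {S} → Kind S → ∣ τ S ∣ ≢ 1 → ∣ τ S ∣ ≡ 2 × τ S ∈ members G × α S ≡ ⊥ × β S ∈ members H
  kind-edge (vertex τ≡1 _ _)        τ≢1 = contradiction τ≡1 τ≢1
  kind-edge (edge τ≡2 e∈G α≡⊥ B∈H) _   = τ≡2 , e∈G , α≡⊥ , B∈H

  kind-size : ∀ {S} → Kind S → ∣ S ∣ ≡ suc (suc w)
  kind-size {S} (vertex τ≡1 A∈F β≡⊥) = trans (∣parts∣ S) (cong₂ _+_ τ≡1
    (trans (cong₂ _+_ (All.lookup ∣F∣≡1+w A∈F) (trans (cong ∣_∣ β≡⊥) (∣⊥∣≡0 n₂))) (+-identityʳ (suc w))))
  kind-size {S} (edge τ≡2 _ α≡⊥ B∈H) = trans (∣parts∣ S) (cong₂ _+_ τ≡2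
    (cong₂ _+_ (trans (cong ∣_∣ α≡⊥) (∣⊥∣≡0 n₁)) (All.lookup ∣H∣≡w B∈H)))

  vertexSet-injective : ∀ {v v′ A A′} → vertexSet v A ≡ vertexSet v′ A′ → v ≡ v′ × A ≡ A′
  vertexSet-injective {v} {v′} {A} {A′} eq
    with v≡ , rest ← Vecₚ.++-injective ⁅ v ⁆ ⁅ v′ ⁆ eq =
    x∈⁅y⁆⇒x≡y v′ (subst (v ∈ˢ_) v≡ (x∈⁅x⁆ v)) , Vecₚ.++-injectiveˡ A A′ rest

  edgeSet-injective : ∀ {e e′ B B′} → edgeSet e B ≡ edgeSet e′ B′ → e ≡ e′ × B ≡ B′
  edgeSet-injective {e} {e′} eq with e≡ , rest ← Vecₚ.++-injective e e′ eq =
    e≡ , Vecₚ.++-injectiveʳ {n = n₁} ⊥ ⊥ rest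

  vertexSets∥edgeSets : ∀ {S} → S ∈ vertexSets → ¬ (S ∈ edgeSets)
  vertexSets∥edgeSets S∈v S∈e
    with v , A , _ , _ , S≡v ← ∈-cartesianProductWith⁻ vertexSet (allFin m) (members F) S∈v
       | e , B , e∈G , _ , S≡e ← ∈-cartesianProductWith⁻ edgeSet (members G) (members H) S∈e
    with Vecₚ.++-injectiveˡ ⁅ v ⁆ e (trans (sym S≡v) S≡e)
  ... | refl = case trans (sym (∣⁅x⁆∣≡1 v)) (All.lookup ∣G∣≡2 e∈G) of λ ()

  K : Family (m + (n₁ + n₂))
  K = family (vertexSets ++ edgeSets) (Uniqueₚ.++⁺
    (Uniqueₚ.cartesianProductWith⁺ vertexSet vertexSet-injective (Uniqueₚ.allFin⁺ m) (distinct F))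
    (Uniqueₚ.cartesianProductWith⁺ edgeSet edgeSet-injective (distinct G) (distinct H))
    (uncurry vertexSets∥edgeSets))

  K-size : size K ≡ m * size F + size G * size H
  K-size = trans (length-++ vertexSets) (cong₂ _+_
    (trans (length-cartesianProductWith vertexSet (allFin m) (members F)) (cong (_* size F) (length-allFin m)))
    (length-cartesianProductWith edgeSet (members G) (members H)))

  K-uniform : Uniform (suc (suc w)) K
  K-uniform = All.tabulate (kind-size ∘ kind)

  F>0 : ∀ {A} → A ∈ members F → 0 < ∣ A ∣
  F>0 A∈F = subst (0 <_) (sym (All.lookup ∣F∣≡1+w A∈F)) z<s

  -- If all the disjoint sets are vertex sets, their `α`-traces form a matching in `F`. Otherwise
  -- the disjoint `τ`-traces are nonempty and one has two vertices, so there are strictly fewer sets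
  -- than the `m` vertices, hence at most `b`.
  K-ν≤ : ∀ {b} → m ≤ suc b → ν F ≤ b → ν K ≤ b
  K-ν≤ {b} m≤1+b νF≤b = ν≤ K bound
    where
    bound : ∀ {Ss} → Ss ⊆ members K → AllPairs Disjoint Ss → length Ss ≤ b
    bound {Ss} Ss⊆K Ss∥ with All.all? (λ S → ∣ τ S ∣ ≟ 1) Ss
    ... | yes allv = ≤-trans (≤-trans (≤-reflexive (sym (length-map α Ss)))
      (length≤ν F αSs⊆F (All.tabulate (F>0 ∘ αSs⊆F))
        (AllPairsₚ.map⁺ (AllPairs.map α-Disjoint Ss∥)))) νF≤b
      where
      αSs⊆F : map α Ss ⊆ members F
      αSs⊆F A∈ with S , S∈ , refl ← ∈-map⁻ α A∈ = proj₁ (kind-vertex (kind (Ss⊆K S∈)) (All.lookup allv S∈))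
    ... | no ¬allv with S , S∈ , τS≢1 ← find (Allₚ.¬All⇒Any¬ (λ S → ∣ τ S ∣ ≟ 1) Ss ¬allv) =
      s≤s⁻¹ (≤-trans (subst (_< sum (map ∣_∣ (map τ Ss))) (length-map τ Ss)
        (length<sum (Allₚ.map⁺ (All.tabulate (kind-∣τ∣>0 ∘ kind ∘ Ss⊆K))) (∈-map⁺ τ S∈)
          (≤-reflexive (sym (proj₁ (kind-edge (kind (Ss⊆K S∈)) τS≢1))))))
        (≤-trans (sum-disjoint≤ (AllPairsₚ.map⁺ (AllPairs.map τ-Disjoint Ss∥))) m≤1+b))

  -- Excluding sunflowers in `K`.

  module Sunflower {k d b : ℕ} (2≤k : 2 ≤ k) (m<k : m < k) (d+b<k : d + b < k)
    (deg : MaxDegree≤ d (members G)) (νF≤b : ν F ≤ b)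
    (F-free : ¬ ContainsSunflower k F) (H-free : ¬ ContainsSunflower k H)
    (S : Fin k → Subset (m + (n₁ + n₂))) (S∈K : ∀ i → S i ∈ members K)
    (S-inj : ∀ {i j} → S i ≡ S j → i ≡ j)
    (C : Subset (m + (n₁ + n₂))) (core : ∀ i j → i ≢ j → S i ∩ S j ≡ C)
    where

    kindS : ∀ i → Kind (S i)
    kindS = kind ∘ S∈K

    τ-core : ∀ {i j} → i ≢ j → τ (S i) ∩ τ (S j) ≡ τ C
    τ-core {i} {j} i≢j = trans (sym (τ-∩ (S i) (S j))) (cong τ (core i j i≢j))

    α-core : ∀ {i j} → i ≢ j → α (S i) ∩ α (S j) ≡ α C
    α-core {i} {j} i≢j = trans (sym (α-∩ (S i) (S j))) (cong α (core i j i≢j))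

    β-core : ∀ {i j} → i ≢ j → β (S i) ∩ β (S j) ≡ β C
    β-core {i} {j} i≢j = trans (sym (β-∩ (S i) (S j))) (cong β (core i j i≢j))

    -- An empty core on Fin m leaves room for at most m petals.
    core-meets-vertices : ¬ Empty (τ C)
    core-meets-vertices τC-empty = <⇒≱ m<k (≤-trans
      (subst (_≤ sum (map ∣_∣ (map (τ ∘ S) (allFin k))))
        (trans (length-map (τ ∘ S) (allFin k)) (length-allFin k))
        (length≤sum (Allₚ.map⁺ {f = τ ∘ S} (All.tabulate {xs = allFin k} λ {i} _ → kind-∣τ∣>0 (kindS i)))))
      (sum-disjoint≤ (AllPairsₚ.map⁺ (AllPairs.map
        (λ i≢j → subst Empty (sym (τ-core i≢j)) τC-empty) (Uniqueₚ.allFin⁺ k)))))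

    module _ {v : Fin m} (v∈C : v ∈ˢ τ C) where

      v∈τ : ∀ i → v ∈ˢ τ (S i)
      v∈τ i with j , i≢j ← another 2≤k i =
        proj₁ (x∈p∩q⁻ (τ (S i)) (τ (S j)) (subst (v ∈ˢ_) (sym (τ-core i≢j)) v∈C))

      -- The trace of the core is an intersection inside `τ (S i)`; being no smaller, it fills it.
      τ≡C : ∀ i → ∣ τ (S i) ∣ ≤ ∣ τ C ∣ → τ (S i) ≡ τ C
      τ≡C i τSi≤C with j , i≢j ← another 2≤k i =
        trans (sym (∣p∩q∣≡∣p∣⇒p∩q≡p (τ (S i)) (τ (S j))
          (≤-antisym (∣p∩q∣≤∣p∣ (τ (S i)) (τ (S j)))
            (subst (λ p → ∣ τ (S i) ∣ ≤ ∣ p ∣) (sym (τ-core i≢j)) τSi≤C))))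
          (τ-core i≢j)

      -- All traces would be the same single vertex and all `β`-traces empty. The members would then
      -- differ only in their `α`-traces, which would form a sunflower in `F` with core `α C`.
      not-all-vertex : ¬ (∀ i → ∣ τ (S i) ∣ ≡ 1)
      not-all-vertex τ≡1 = F-free
        ( α ∘ S , proj₁ ∘ isVertex
        , (λ {i} {j} αi≡αj → S-inj (parts-injective
            (trans (τ≡ i) (sym (τ≡ j))) αi≡αj (trans (proj₂ (isVertex i)) (sym (proj₂ (isVertex j))))))
        , α C , λ _ _ → α-core )
        where
        isVertex : ∀ i → α (S i) ∈ members F × β (S i) ≡ ⊥
        isVertex i = kind-vertex (kindS i) (τ≡1 i)
        τ≡ : ∀ i → τ (S i) ≡ τ C
        τ≡ i = τ≡C i (subst (_≤ ∣ τ C ∣) (sym (τ≡1 i)) (x∈p⇒∣p∣>0 v∈C))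

      -- No trace exceeds two vertices, so all would equal the core's. The members would be edge
      -- sets over one edge, and their `β`-traces would form a sunflower in `H`.
      core-not-edge : ∣ τ C ∣ ≢ 2
      core-not-edge ∣C∣≡2 = H-free
        ( β ∘ S , proj₂ ∘ isEdge
        , (λ {i} {j} βi≡βj → S-inj (parts-injective
            (trans (τ≡ i) (sym (τ≡ j))) (trans (proj₁ (isEdge i)) (sym (proj₁ (isEdge j)))) βi≡βj))
        , β C , λ _ _ → β-core )
        where
        τ≡ : ∀ i → τ (S i) ≡ τ C
        τ≡ i = τ≡C i (subst (∣ τ (S i) ∣ ≤_) (sym ∣C∣≡2) (kind-∣τ∣≤2 (kindS i)))
        isEdge : ∀ i → α (S i) ≡ ⊥ × β (S i) ∈ members H
        isEdge i with _ , _ , α≡⊥ , β∈H ← kind-edge (kindS i)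
          (λ τ≡1 → case trans (sym τ≡1) (trans (cong ∣_∣ (τ≡ i)) ∣C∣≡2) of λ ()) = α≡⊥ , β∈H

      isVertex? : ∀ i → Dec (∣ τ (S i) ∣ ≡ 1)
      isVertex? i = ∣ τ (S i) ∣ ≟ 1

      vs es : List (Fin k)
      vs = filter isVertex? (allFin k)
      es = filter (¬? ∘ isVertex?) (allFin k)

      -- Two edge sets over the same edge would put that whole edge into the core, contrary to
      -- `core-not-edge`. Hence the edges are distinct, and all contain `v`.
      es≤d : length es ≤ d
      es≤d = ≤-trans
        (subst (_≤ length star) (length-map (τ ∘ S) es) (Unique-⊆⇒length≤ τes-unique τes⊆star))
        (proj₁ (proj₂ (deg v)))
        where
        star = proj₁ (deg v)
        edge-∈ : ∀ {i} → i ∈ es → ∣ τ (S i) ∣ ≢ 1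
        edge-∈ i∈ = proj₂ (∈-filter⁻ (¬? ∘ isVertex?) {xs = allFin k} i∈)
        τ-distinct : ∀ {i j} → i ∈ es → j ∈ es → i ≢ j → τ (S i) ≢ τ (S j)
        τ-distinct {i} {j} i∈ _ i≢j τi≡τj =
          core-not-edge (trans (cong ∣_∣ C≡τi) (proj₁ (kind-edge (kindS i) (edge-∈ i∈))))
          where
          C≡τi : τ C ≡ τ (S i)
          C≡τi = trans (sym (τ-core i≢j)) (trans (cong (τ (S i) ∩_) (sym τi≡τj)) (∩-idem (τ (S i))))
        τes-unique : Unique (map (τ ∘ S) es)
        τes-unique =
          AllPairsₚ.map⁺ (Unique⇒AllPairs τ-distinct (Uniqueₚ.filter⁺ (¬? ∘ isVertex?) (Uniqueₚ.allFin⁺ k)))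
        τes⊆star : map (τ ∘ S) es ⊆ star
        τes⊆star e∈ with i , i∈ , refl ← ∈-map⁻ (τ ∘ S) e∈ =
          proj₂ (proj₂ (deg v)) (proj₁ (proj₂ (kind-edge (kindS i) (edge-∈ i∈)))) (v∈τ i)

      -- Some member is an edge set, so the core misses the ground set of F.
      vs≤b : length vs ≤ b
      vs≤b with a , τa≢1 ← ¬∀⟶∃¬ k _ isVertex? not-all-vertex
           with _ , _ , αa≡⊥ , _ ← kind-edge (kindS a) τa≢1
           with j , a≢j ← another 2≤k a =
        ≤-trans (subst (_≤ ν F) (length-map (α ∘ S) vs)
          (length≤ν F αvs⊆F (All.tabulate (F>0 ∘ αvs⊆F))
            (AllPairsₚ.map⁺ (AllPairs.map (λ i≢j → subst Empty (sym (α-core i≢j)) αC-empty)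
              (Uniqueₚ.filter⁺ isVertex? (Uniqueₚ.allFin⁺ k)))))) νF≤b
        where
        αC-empty : Empty (α C)
        αC-empty = ∣∣≡0⇒Empty (trans (cong ∣_∣ (trans (sym (α-core a≢j)) (cong (_∩ α (S j)) αa≡⊥))) (∣⊥∩p∣≡0 (α (S j))))
        αvs⊆F : map (α ∘ S) vs ⊆ members F
        αvs⊆F A∈ with i , i∈ , refl ← ∈-map⁻ (α ∘ S) A∈ =
          proj₁ (kind-vertex (kindS i) (proj₂ (∈-filter⁻ isVertex? {xs = allFin k} i∈)))

      k≤d+b : k ≤ d + b
      k≤d+b = begin
        k                       ≡⟨ length-allFin k ⟨
        length (allFin k)       ≡⟨ length-filter-¬ isVertex? (allFin k) ⟩
        length vs + length es   ≤⟨ +-mono-≤ vs≤b es≤d ⟩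
        b + d                   ≡⟨ +-comm b d ⟩
        d + b                   ∎
        where open ≤-Reasoning

    impossible : Void.⊥
    impossible with nonempty? (τ C)
    ... | yes (v , v∈C) = <⇒≱ d+b<k (k≤d+b v∈C)
    ... | no  empty     = core-meets-vertices empty

  K-sunflower-free : ∀ {k d b} → 2 ≤ k → m < k → d + b < k → MaxDegree≤ d (members G) → ν F ≤ b →
    ¬ ContainsSunflower k F → ¬ ContainsSunflower k H → ¬ ContainsSunflower k K
  K-sunflower-free 2≤k m<k d+b<k deg νF≤b F-free H-free (S , S∈K , S-inj , C , core) =
    Sunflower.impossible 2≤k m<k d+b<k deg νF≤b F-free H-free S S∈K S-inj C core

theoremA2 : (k m : ℕ) → 3 ≤ k → 2 ≤ m → m ≤ k ∸ 1 →
    (w : ℕ) → 3 ≤ w →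
    (ψw ψw-1 fw-2 : ℕ) →
    ψ[ w , k , m ]≡ ψw →
    ψ[ w ∸ 1 , k , m ]≡ ψw-1 →
    f[ w ∸ 2 , k ]≡ fw-2 →
    ψw ≥ m * ψw-1 + E m k * fw-2
theoremA2 (suc k) (suc m) 3≤k 2≤m m≤k (suc (suc (suc w))) (s≤s (s≤s (s≤s _))) ψw ψw-1 fw-2
  (_ , maximal)
  ((n₁ , F , (F-uniform , F-free , νF≤m) , F-size) , _)
  ((n₂ , H , (H-uniform , H-free) , H-size) , _)
  -- After matching, `m` and `k` are one less than in the statement. The second term of the minimum
  -- keeps the degree below the number of vertices.
  with G , G-uniform , deg , G-size ← nearRegularGraph (suc m) (d (suc m) (suc k)) (s≤s (m⊓n≤n (k ∸ m) m))
  = subst (_≤ ψw) (trans K-size (cong₂ _+_ (cong (suc m *_) F-size) (cong₂ _*_ G-size H-size)))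
      (maximal K (K-uniform , K-sunflower-free (≤-trans (n≤1+n 2) 3≤k) (s≤s m≤k) d+m<1+k deg νF≤m F-free H-free
        , K-ν≤ ≤-refl νF≤m))
  where
  open Construction G F H G-uniform F-uniform H-uniform
  -- The first term of the minimum is what bounds edge sets and vertex sets together below the
  -- sunflower size.
  d+m<1+k : d (suc m) (suc k) + m < suc k
  d+m<1+k = s≤s (≤-trans (+-monoˡ-≤ m (m⊓n≤m (k ∸ m) m)) (≤-reflexive (m∸n+n≡m (≤-trans (n≤1+n m) m≤k))))
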